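{- Let $\alpha\in(0,1)$ be irrational, let $\mathcal{L}_\alpha$ be the Sturmian language generated by $\alpha$, and let $q_n=[(n+1)\alpha]$ for $n\ge0$. Let ${\rm S}:\mathcal{L}_\alpha\to\mathbb{N}$ be a homomorphism, and write ${\rm S}_0={\rm S}(0)$, ${\rm S}_1={\rm S}(1)$. Then $${\rm S}(\mathcal{L}_\alpha)=\{({\rm S}_1-{\rm S}_0)q_n+n{\rm S}_0+{\rm S}_0:\ n\ge0\}\ \cup\ \{({\rm S}_1-{\rm S}_0)q_n+n{\rm S}_0+{\rm S}_1:\ n\ge0\}.$$
   Context: $\mathbb{N}=\{1,2,3,\dots\}$ and $[x]$ denotes the integer part (floor) of $x$. For irrational $\alpha\in(0,1)$, the characteristic word $c_\alpha=(c_\alpha(n))_{n\ge0}$ is the infinite word over $\{0,1\}$ with $c_\alpha(n)=[(n+2)\alpha]-[(n+1)\alpha]$. The Sturmian language $\mathcal{L}_\alpha$ is the set of all nonempty finite words occurring as factors (subwords) of $c_\alpha$ (equivalently, of $0c_\alpha$ or of $1c_\alpha$). A homomorphism ${\rm S}:\mathcal{L}_\alpha\to\mathbb{N}$ is a map with ${\rm S}(w_1\cdots w_n)={\rm S}(w_1)+\cdots+{\rm S}(w_n)$, determined by ${\rm S}(0),{\rm S}(1)\in\mathbb{N}$. -}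

module Defs where

open import Data.Empty using (⊥-elim)
open import Data.Fin.Base using (Fin; zero; suc; toℕ; fromℕ<)
open import Data.Fin.Properties using (toℕ-fromℕ<)
open import Data.Integer.Base as ℤ using (ℤ; +_; -[1+_]; +[1+_])
import Data.Integer.Properties as ℤ
open import Data.Integer.Tactic.RingSolver using (solve-∀)
open import Data.List.Base as List using ([]; _∷_; applyUpTo)
open import Data.List.NonEmpty.Base as List⁺ using (List⁺; _∷_; toList; length)
open import Data.Nat.Base as ℕ using (ℕ; zero; suc; z≤n; s≤s)
open import Data.Nat.ListAction using (sum)
import Data.Nat.Properties as ℕ
open import Data.Product.Base using (∃; ∃-syntax; _×_; _,_; proj₁; proj₂)
open import Data.Rational.Base as ℚ using (ℚ; mkℚ; 0ℚ; 1ℚ; _/_; toℚᵘ)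
import Data.Rational.Properties as ℚ
open import Data.Rational.Unnormalised.Base as ℚᵘ using (mkℚᵘ; *≡*; *<*; *≤*)
import Data.Rational.Unnormalised.Properties as ℚᵘ
open import Data.Sum.Base using (_⊎_; inj₁; inj₂; [_,_]′)
open import Function.Base using (id)
open import Level using (0ℓ)
open import Relation.Binary.Definitions using (tri<; tri≈; tri>)
open import Relation.Binary.PropositionalEquality
  using (_≡_; refl; sym; trans; cong; cong₂; subst; subst₂)
open import Relation.Nullary.Negation using (¬_)
open import Relation.Unary using (Pred; _∈_)

------------------------------------------------------------------------
-- Real numbers as two-sided Dedekind cuts: Lower q reads q < x and
-- Upper q reads x < q.

record ℝ : Set₁ where
  field
    Lower Upper     : Pred ℚ 0ℓ
    lower-inhabited : ∃ Lower
    upper-inhabited : ∃ Upper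
    lower-closed    : ∀ {q r} → q ℚ.< r → Lower r → Lower q
    upper-closed    : ∀ {q r} → q ℚ.< r → Upper q → Upper r
    lower-open      : ∀ {q} → Lower q → ∃[ r ] q ℚ.< r × Lower r
    upper-open      : ∀ {r} → Upper r → ∃[ q ] q ℚ.< r × Upper q
    disjoint        : ∀ {q} → ¬ (Lower q × Upper q)
    located         : ∀ {q r} → q ℚ.< r → Lower q ⊎ Upper r

open ℝ public

infix 4 _<ʳ_ _ʳ<_

_<ʳ_ : ℚ → ℝ → Set
q <ʳ x = Lower x q

_ʳ<_ : ℝ → ℚ → Set
x ʳ< q = Upper x q

-- Irrationality in its usual constructive form: x is apart from every
-- rational.  Classically this says that x equals no rational.
Irrational : ℝ → Set
Irrational x = ∀ q → q <ʳ x ⊎ x ʳ< q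

lower-≤ : ∀ x {q r} → q ℚ.≤ r → r <ʳ x → q <ʳ x
lower-≤ x {q} {r} q≤r r<x with ℚ.<-cmp q r
... | tri< q<r _ _ = lower-closed x q<r r<x
... | tri≈ _ refl _ = r<x
... | tri> _ _ r<q = ⊥-elim (ℚ.<-irrefl refl (ℚ.<-≤-trans r<q q≤r))

upper-≤ : ∀ x {q r} → q ℚ.≤ r → x ʳ< q → x ʳ< r
upper-≤ x {q} {r} q≤r x<q with ℚ.<-cmp q r
... | tri< q<r _ _ = upper-closed x q<r x<q
... | tri≈ _ refl _ = x<q
... | tri> _ _ r<q = ⊥-elim (ℚ.<-irrefl refl (ℚ.<-≤-trans r<q q≤r))

lower<upper : ∀ x {q r} → q <ʳ x → x ʳ< r → q ℚ.< r
lower<upper x {q} {r} q<x x<r with ℚ.<-cmp q r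
... | tri< q<r _ _ = q<r
... | tri≈ _ refl _ = ⊥-elim (disjoint x (q<x , x<r))
... | tri> _ _ r<q = ⊥-elim (disjoint x (lower-closed x r<q q<x , x<r))

------------------------------------------------------------------------
-- Positive integer multiples: q < k x  iff  q / k < x.

1/-positive : ∀ k .{{_ : ℕ.NonZero k}} → ℚ.Positive (+ 1 / k)
1/-positive (suc k) = ℚ.normalize-pos 1 (suc k)

k/1-positive : ∀ k .{{_ : ℕ.NonZero k}} → ℚ.Positive (+ k / 1)
k/1-positive (suc k) = ℚ.normalize-pos (suc k) 1

/1*1/ : ∀ m k .{{_ : ℕ.NonZero k}} → (m / 1) ℚ.* (+ 1 / k) ≡ m / k
/1*1/ m (suc k) = ℚ.toℚᵘ-injective (begin
  toℚᵘ ((m / 1) ℚ.* (+ 1 / suc k))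
    ≈⟨ ℚ.toℚᵘ-homo-* (m / 1) (+ 1 / suc k) ⟩
  toℚᵘ (m / 1) ℚᵘ.* toℚᵘ (+ 1 / suc k)
    ≈⟨ ℚᵘ.*-cong (ℚ.toℚᵘ-fromℚᵘ (mkℚᵘ m 0)) (ℚ.toℚᵘ-fromℚᵘ (mkℚᵘ (+ 1) k)) ⟩
  mkℚᵘ m 0 ℚᵘ.* mkℚᵘ (+ 1) k
    ≈⟨ *≡* (cong₂ ℤ._*_ (ℤ.*-identityʳ m) (cong +_ (sym (ℕ.+-identityʳ (suc k))))) ⟩
  mkℚᵘ m k
    ≈⟨ ℚ.toℚᵘ-fromℚᵘ (mkℚᵘ m k) ⟨
  toℚᵘ (m / suc k) ∎)
  where open ℚᵘ.≃-Reasoning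

k*1/k : ∀ k .{{_ : ℕ.NonZero k}} → (+ k / 1) ℚ.* (+ 1 / k) ≡ 1ℚ
k*1/k (suc k) = trans (/1*1/ (+ suc k) (suc k))
  (ℚ.fromℚᵘ-cong {mkℚᵘ (+ suc k) k} {mkℚᵘ (+ 1) 0}
    (*≡* (trans (ℤ.*-identityʳ (+ suc k)) (sym (ℤ.*-identityˡ (+ suc k))))))

scale-unscale : ∀ k .{{_ : ℕ.NonZero k}} q → (q ℚ.* (+ k / 1)) ℚ.* (+ 1 / k) ≡ q
scale-unscale k q = trans (ℚ.*-assoc q _ _)
  (trans (cong (q ℚ.*_) (k*1/k k)) (ℚ.*-identityʳ q))

unscale-scale : ∀ k .{{_ : ℕ.NonZero k}} q → (q ℚ.* (+ 1 / k)) ℚ.* (+ k / 1) ≡ q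
unscale-scale k q = trans (ℚ.*-assoc q _ _)
  (trans (cong (q ℚ.*_) (trans (ℚ.*-comm (+ 1 / k) (+ k / 1)) (k*1/k k)))
    (ℚ.*-identityʳ q))

÷-mono-< : ∀ k .{{_ : ℕ.NonZero k}} {q r} → q ℚ.< r →
           q ℚ.* (+ 1 / k) ℚ.< r ℚ.* (+ 1 / k)
÷-mono-< k = ℚ.*-monoˡ-<-pos (+ 1 / k) {{1/-positive k}}

·-mono-< : ∀ k .{{_ : ℕ.NonZero k}} {q r} → q ℚ.< r →
           q ℚ.* (+ k / 1) ℚ.< r ℚ.* (+ k / 1)
·-mono-< k = ℚ.*-monoˡ-<-pos (+ k / 1) {{k/1-positive k}}

infixr 7 _·_

_·_ : (k : ℕ) .{{_ : ℕ.NonZero k}} → ℝ → ℝ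
(k · x) .Lower q = q ℚ.* (+ 1 / k) <ʳ x
(k · x) .Upper q = x ʳ< q ℚ.* (+ 1 / k)
(k · x) .lower-inhabited = let (q , q<x) = lower-inhabited x in
  q ℚ.* (+ k / 1) , subst (Lower x) (sym (scale-unscale k q)) q<x
(k · x) .upper-inhabited = let (q , x<q) = upper-inhabited x in
  q ℚ.* (+ k / 1) , subst (Upper x) (sym (scale-unscale k q)) x<q
(k · x) .lower-closed q<r = lower-closed x (÷-mono-< k q<r)
(k · x) .upper-closed q<r = upper-closed x (÷-mono-< k q<r)
(k · x) .lower-open {q} q<kx = let (r , q/k<r , r<x) = lower-open x q<kx in
  r ℚ.* (+ k / 1)
  , subst (ℚ._< r ℚ.* (+ k / 1)) (unscale-scale k q) (·-mono-< k q/k<r)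
  , subst (Lower x) (sym (scale-unscale k r)) r<x
(k · x) .upper-open {r} kx<r = let (q , q<r/k , x<q) = upper-open x kx<r in
  q ℚ.* (+ k / 1)
  , subst (q ℚ.* (+ k / 1) ℚ.<_) (unscale-scale k r) (·-mono-< k q<r/k)
  , subst (Upper x) (sym (scale-unscale k q)) x<q
(k · x) .disjoint = disjoint x
(k · x) .located q<r = located x (÷-mono-< k q<r)

·-irrational : ∀ k .{{_ : ℕ.NonZero k}} x → Irrational x → Irrational (k · x)
·-irrational k x irr q = irr (q ℚ.* (+ 1 / k))

------------------------------------------------------------------------
-- Integer part of an irrational number.  As m ≤ x amounts to m < x here,
-- the defining property is  m < x < m + 1.

IsFloor : ℝ → Pred ℤ 0ℓ
IsFloor x m = (m / 1) <ʳ x × x ʳ< (ℤ.suc m / 1)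

/-mono-≤ : ∀ m k n l → m ℤ.* + suc l ℤ.≤ n ℤ.* + suc k → m / suc k ℚ.≤ n / suc l
/-mono-≤ m k n l le = ℚ.toℚᵘ-cancel-≤
  (ℚᵘ.≤-respˡ-≃ (ℚᵘ.≃-sym (ℚ.toℚᵘ-fromℚᵘ (mkℚᵘ m k)))
    (ℚᵘ.≤-respʳ-≃ (ℚᵘ.≃-sym (ℚ.toℚᵘ-fromℚᵘ (mkℚᵘ n l))) (*≤* le)))

/-cancel-< : ∀ m k n l → m / suc k ℚ.< n / suc l → m ℤ.* + suc l ℤ.< n ℤ.* + suc k
/-cancel-< m k n l lt with
  ℚᵘ.<-respˡ-≃ (ℚ.toℚᵘ-fromℚᵘ (mkℚᵘ m k))
    (ℚᵘ.<-respʳ-≃ (ℚ.toℚᵘ-fromℚᵘ (mkℚᵘ n l)) (ℚ.toℚᵘ-mono-< lt))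
... | *<* p = p

≤-numerator : ∀ q → q ℚ.≤ + ℤ.∣ ℚ.↥ q ∣ / 1
≤-numerator q@(mkℚ (+ n) d _) = subst (ℚ._≤ + n / 1) (ℚ.fromℚᵘ-toℚᵘ q)
  (/-mono-≤ (+ n) d (+ n) 0
    (ℤ.*-monoˡ-≤-nonNeg (+ n) (ℤ.+≤+ (s≤s z≤n))))
≤-numerator q@(mkℚ -[1+ n ] d _) = subst (ℚ._≤ + suc n / 1) (ℚ.fromℚᵘ-toℚᵘ q)
  (/-mono-≤ -[1+ n ] d (+ suc n) 0 ℤ.-≤+)

-numerator≤ : ∀ q → ℤ.- (+ ℤ.∣ ℚ.↥ q ∣) / 1 ℚ.≤ q
-numerator≤ q@(mkℚ (+ n) d _) = subst (ℤ.- (+ n) / 1 ℚ.≤_) (ℚ.fromℚᵘ-toℚᵘ q)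
  (/-mono-≤ (ℤ.- (+ n)) 0 (+ n) d
    (subst₂ ℤ._≤_ (ℤ.neg-distribˡ-* (+ n) (+ suc d)) (sym (ℤ.*-identityʳ (+ n)))
      (ℤ.≤-trans (ℤ.neg-mono-≤ {+ 0} (subst (+ 0 ℤ.≤_) (ℤ.pos-* n (suc d)) (ℤ.+≤+ z≤n))) (ℤ.+≤+ z≤n))))
-numerator≤ q@(mkℚ -[1+ n ] d _) = subst (-[1+ n ] / 1 ℚ.≤_) (ℚ.fromℚᵘ-toℚᵘ q)
  (/-mono-≤ -[1+ n ] 0 -[1+ n ] d
    (ℤ.*-monoˡ-≤-nonPos -[1+ n ] (ℤ.+≤+ (s≤s z≤n))))

search : ∀ x → Irrational x → ∀ k m → (m / 1) <ʳ x → x ʳ< ((m ℤ.+ + k) / 1) →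
         ∃ (IsFloor x)
search x irr zero m m<x x<m+0 = ⊥-elim
  (disjoint x (m<x , subst (λ i → x ʳ< (i / 1)) (ℤ.+-identityʳ m) x<m+0))
search x irr (suc k) m m<x x<m+k with irr (ℤ.suc m / 1)
... | inj₂ x<1+m = m , m<x , x<1+m
... | inj₁ 1+m<x = search x irr k (ℤ.suc m) 1+m<x
  (subst (λ i → x ʳ< (i / 1)) (shift m (+ k)) x<m+k)
  where
  shift : ∀ m k → m ℤ.+ (+ 1 ℤ.+ k) ≡ (+ 1 ℤ.+ m) ℤ.+ k
  shift = solve-∀

opaque
  floor-exists : ∀ x → Irrational x → ∃ (IsFloor x)
  floor-exists x irr = search x irr (a ℕ.+ b) (ℤ.- + a)
    (lower-≤ x (-numerator≤ l) l<x)
    (subst (λ i → x ʳ< (i / 1)) (cancel (+ a) (+ b)) (upper-≤ x (≤-numerator u) x<u))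
    where
    l u : ℚ
    l = proj₁ (lower-inhabited x)
    u = proj₁ (upper-inhabited x)
    l<x : l <ʳ x
    l<x = proj₂ (lower-inhabited x)
    x<u : x ʳ< u
    x<u = proj₂ (upper-inhabited x)
    a b : ℕ
    a = ℤ.∣ ℚ.↥ l ∣
    b = ℤ.∣ ℚ.↥ u ∣
    cancel : ∀ a b → b ≡ ℤ.- a ℤ.+ (a ℤ.+ b)
    cancel = solve-∀

floor : ∀ x → Irrational x → ℤ
floor x irr = proj₁ (floor-exists x irr)

floor-isFloor : ∀ x (irr : Irrational x) → IsFloor x (floor x irr)
floor-isFloor x irr = proj₂ (floor-exists x irr)

------------------------------------------------------------------------
-- Sturmian words and languages

Letter : Set
Letter = Fin 2

Word : Set
Word = List⁺ Letter

IsFactorOf : Word → (ℕ → Letter) → Set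
IsFactorOf w c = ∃[ i ] toList w ≡ applyUpTo (λ k → c (i ℕ.+ k)) (length w)

module Sturmian (α : ℝ) (α-irrational : Irrational α) (0<α : 0ℚ <ʳ α) (α<1 : α ʳ< 1ℚ) where

  ⌊_·α⌋ : (k : ℕ) .{{_ : ℕ.NonZero k}} → ℤ
  ⌊ k ·α⌋ = floor (k · α) (·-irrational k α α-irrational)

  q : ℕ → ℤ
  q n = ⌊ suc n ·α⌋

  compare : ∀ k l m n → (m / 1) <ʳ suc k · α → suc l · α ʳ< (n / 1) →
            m ℤ.* + suc l ℤ.< n ℤ.* + suc k
  compare k l m n m<kα lα<n = /-cancel-< m k n l
    (subst₂ ℚ._<_ (/1*1/ m (suc k)) (/1*1/ n (suc l)) (lower<upper α m<kα lα<n))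

  q-lower : ∀ n → (q n / 1) <ʳ suc n · α
  q-lower n = proj₁ (floor-isFloor (suc n · α) (·-irrational (suc n) α α-irrational))

  q-upper : ∀ n → suc n · α ʳ< (ℤ.suc (q n) / 1)
  q-upper n = proj₂ (floor-isFloor (suc n · α) (·-irrational (suc n) α α-irrational))

  0<suc⇒0≤ : ∀ i → + 0 ℤ.< ℤ.suc i ℤ.* + 1 → + 0 ℤ.≤ i
  0<suc⇒0≤ i 0<1+i = subst (+ 0 ℤ.≤_) (ℤ.pred-suc i)
    (ℤ.i<j⇒i≤pred[j] {+ 0} {ℤ.suc i} (subst (+ 0 ℤ.<_) (ℤ.*-identityʳ (ℤ.suc i)) 0<1+i))

  0≤q : ∀ n → + 0 ℤ.≤ q n
  0≤q n = 0<suc⇒0≤ (q n) (compare 0 n (+ 0) (ℤ.suc (q n)) 0<α (q-upper n))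

  qℕ : ℕ → ℕ
  qℕ n = ℤ.∣ q n ∣

  +qℕ : ∀ n → + qℕ n ≡ q n
  +qℕ n = ℤ.0≤i⇒+∣i∣≡i (0≤q n)

  qℕ-lower : ∀ n → (+ qℕ n / 1) <ʳ suc n · α
  qℕ-lower n = subst (λ i → (i / 1) <ʳ suc n · α) (sym (+qℕ n)) (q-lower n)

  qℕ-upper : ∀ n → suc n · α ʳ< (+ suc (qℕ n) / 1)
  qℕ-upper n = subst (λ i → suc n · α ʳ< (ℤ.suc i / 1)) (sym (+qℕ n)) (q-upper n)

  compareℕ : ∀ k l m n → (+ m / 1) <ʳ suc k · α → suc l · α ʳ< (+ n / 1) →
             m ℕ.* suc l ℕ.< n ℕ.* suc k
  compareℕ k l m n p r = ℤ.drop‿+<+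
    (subst₂ ℤ._<_ (sym (ℤ.pos-* m (suc l))) (sym (ℤ.pos-* n (suc k)))
      (compare k l (+ m) (+ n) p r))

  qℕ≤ : ∀ n → qℕ n ℕ.≤ n
  qℕ≤ n = ℕ.≤-pred (subst₂ ℕ._<_ (ℕ.*-identityʳ (qℕ n)) (ℕ.*-identityˡ (suc n))
    (compareℕ n 0 (qℕ n) 1 (qℕ-lower n) α<1))

  step-lower : ∀ a b k → a ℕ.* suc k ℕ.< suc b ℕ.* k → a ℕ.≤ b
  step-lower a b k lt = ℕ.≮⇒≥ λ b<a → ℕ.<⇒≱ lt
    (ℕ.*-mono-≤ b<a (ℕ.n≤1+n k))

  step-upper : ∀ a b k → b ℕ.≤ k → b ℕ.* k ℕ.< suc a ℕ.* suc k → b ℕ.≤ suc a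
  step-upper a b k b≤k lt = ℕ.≮⇒≥ λ 2+a≤b → ℕ.<⇒≱ lt (begin
    suc a ℕ.* suc k           ≡⟨ ℕ.*-suc (suc a) k ⟩
    suc a ℕ.+ suc a ℕ.* k     ≤⟨ ℕ.+-monoˡ-≤ _ (ℕ.≤-trans (ℕ.n≤1+n _) (ℕ.≤-trans 2+a≤b b≤k)) ⟩
    suc (suc a) ℕ.* k         ≤⟨ ℕ.*-monoˡ-≤ k 2+a≤b ⟩
    b ℕ.* k                   ∎)
    where open ℕ.≤-Reasoning

  qℕ-mono : ∀ n → qℕ n ℕ.≤ qℕ (suc n)
  qℕ-mono n = step-lower (qℕ n) (qℕ (suc n)) (suc n)
    (compareℕ n (suc n) (qℕ n) (suc (qℕ (suc n))) (qℕ-lower n) (qℕ-upper (suc n)))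

  qℕ-step : ∀ n → qℕ (suc n) ℕ.≤ suc (qℕ n)
  qℕ-step n = step-upper (qℕ n) (qℕ (suc n)) (suc n) (qℕ≤ (suc n))
    (compareℕ (suc n) n (qℕ (suc n)) (suc (qℕ n)) (qℕ-lower (suc n)) (qℕ-upper n))

  difference : ∀ n → q (suc n) ℤ.- q n ≡ + (qℕ (suc n) ℕ.∸ qℕ n)
  difference n = trans (cong₂ ℤ._-_ (sym (+qℕ (suc n))) (sym (+qℕ n)))
    (trans (ℤ.m-n≡m⊖n (qℕ (suc n)) (qℕ n)) (ℤ.⊖-≥ (qℕ-mono n)))

  difference-<2 : ∀ n → ℤ.∣ ⌊ suc (suc n) ·α⌋ ℤ.- ⌊ suc n ·α⌋ ∣ ℕ.< 2
  difference-<2 n = s≤s (subst (ℕ._≤ 1) (cong ℤ.∣_∣ (sym (difference n)))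
    (ℕ.≤-trans (ℕ.∸-monoˡ-≤ (qℕ n) (qℕ-step n)) (ℕ.≤-reflexive (ℕ.m+n∸n≡m 1 (qℕ n)))))

  -- The difference is 0 or 1, so the absolute value does nothing: see c-formula.
  opaque
    c : ℕ → Letter
    c n = fromℕ< (difference-<2 n)

    c-formula : ∀ n → + toℕ (c n) ≡ ⌊ suc (suc n) ·α⌋ ℤ.- ⌊ suc n ·α⌋
    c-formula n = trans
      (cong +_ (trans (toℕ-fromℕ< (difference-<2 n)) (cong ℤ.∣_∣ (difference n))))
      (sym (difference n))

  𝓛 : Pred Word 0ℓ
  𝓛 w = IsFactorOf w c

  q₀≡0 : q 0 ≡ + 0
  q₀≡0 = trans (sym (+qℕ 0)) (cong +_ (ℕ.n≤0⇒n≡0 (qℕ≤ 0)))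

  q-suc : ∀ n → q (suc n) ≡ + toℕ (c n) ℤ.+ q n
  q-suc n = trans (add (q (suc n)) (q n)) (cong (ℤ._+ q n) (sym (c-formula n)))
    where
    add : ∀ i j → i ≡ (i ℤ.- j) ℤ.+ j
    add = solve-∀

  step-1 : ∀ n a → c n ≡ a → q n ≡ + 0 → q (suc n) ≡ + 0 ⊎ ∃[ i ] c i ≡ suc zero
  step-1 n (suc zero) eq _    = inj₂ (n , eq)
  step-1 n zero       eq qn≡0 = inj₁
    (trans (q-suc n) (cong₂ (λ a i → + toℕ a ℤ.+ i) eq qn≡0))

  search-1 : ∀ n → q n ≡ + 0 ⊎ ∃[ i ] c i ≡ suc zero
  search-1 zero    = inj₁ q₀≡0
  search-1 (suc n) = [ step-1 n (c n) refl , inj₂ ]′ (search-1 n)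

  step-0 : ∀ n a → c n ≡ a → q n ≡ + n → q (suc n) ≡ + suc n ⊎ ∃[ i ] c i ≡ zero
  step-0 n zero       eq _    = inj₂ (n , eq)
  step-0 n (suc zero) eq qn≡n = inj₁
    (trans (q-suc n) (cong₂ (λ a i → + toℕ a ℤ.+ i) eq qn≡n))

  search-0 : ∀ n → q n ≡ + n ⊎ ∃[ i ] c i ≡ zero
  search-0 zero    = inj₁ q₀≡0
  search-0 (suc n) = [ step-0 n (c n) refl , inj₂ ]′ (search-0 n)

  q≥1⇒1-occurs : ∀ d → (+ 1 / 1) <ʳ suc d · α → ∃[ i ] c i ≡ suc zero
  q≥1⇒1-occurs d 1<dα = [ (λ qd≡0 → ⊥-elim (disjoint (suc d · α) {+ 1 / 1} (1<dα ,
    subst (λ i → suc d · α ʳ< (ℤ.suc i / 1)) qd≡0 (q-upper d)))) , id ]′ (search-1 d)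

  q<d⇒0-occurs : ∀ d → suc d · α ʳ< (+ d / 1) → ∃[ i ] c i ≡ zero
  q<d⇒0-occurs d dα<d = [ (λ qd≡d → ⊥-elim (disjoint (suc d · α) {+ d / 1}
    (subst (λ i → (i / 1) <ʳ suc d · α) qd≡d (q-lower d) , dα<d))) , id ]′ (search-0 d)

  positive⇒1/d≤ : ∀ r → 0ℚ ℚ.< r → ∃[ d ] + 1 / suc d ℚ.≤ r
  positive⇒1/d≤ (mkℚ (+ zero) d _) (ℚ.*<* 0<0) = ⊥-elim (ℤ.<-irrefl refl 0<0)
  positive⇒1/d≤ (mkℚ -[1+ n ] d _) (ℚ.*<* ())
  positive⇒1/d≤ r@(mkℚ +[1+ n ] d _) _ = d ,
    subst (+ 1 / suc d ℚ.≤_) (ℚ.fromℚᵘ-toℚᵘ r)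
      (/-mono-≤ (+ 1) d +[1+ n ] d
        (ℤ.*-monoʳ-≤-nonNeg (+ suc d) {+ 1} {+[1+ n ]} (ℤ.+≤+ (s≤s z≤n))))

  <1⇒≤d/1+d : ∀ r → r ℚ.< 1ℚ → ∃[ d ] r ℚ.≤ + d / suc d
  <1⇒≤d/1+d r@(mkℚ n d _) (ℚ.*<* n<d) = d ,
    subst (ℚ._≤ + d / suc d) (ℚ.fromℚᵘ-toℚᵘ r)
      (/-mono-≤ n d (+ d) d (ℤ.*-monoʳ-≤-nonNeg (+ suc d) {n} {+ d}
        (ℤ.i<j⇒i≤pred[j]
          (subst₂ ℤ._<_ (ℤ.*-identityʳ n) (ℤ.*-identityˡ (+ suc d)) n<d))))

  1-occurs : ∃[ i ] c i ≡ suc zero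
  1-occurs =
    let (r , 0<r , r<α) = lower-open α 0<α
        (d , 1/d≤r)     = positive⇒1/d≤ r 0<r
    in q≥1⇒1-occurs d (subst (Lower α) (sym (/1*1/ (+ 1) (suc d))) (lower-≤ α 1/d≤r r<α))

  0-occurs : ∃[ i ] c i ≡ zero
  0-occurs =
    let (r , r<1 , α<r) = upper-open α α<1
        (d , r≤d/1+d)   = <1⇒≤d/1+d r r<1
    in q<d⇒0-occurs d (subst (Upper α) (sym (/1*1/ (+ d) (suc d))) (upper-≤ α r≤d/1+d α<r))

  occurs⇒∈ : ∀ {a} → ∃[ i ] c i ≡ a → List⁺.[ a ] ∈ 𝓛
  occurs⇒∈ {a} (i , ci≡a) = i , cong (_∷ [])
    (trans (sym ci≡a) (cong c (sym (ℕ.+-identityʳ i))))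

  letter∈𝓛 : ∀ a → List⁺.[ a ] ∈ 𝓛
  letter∈𝓛 zero       = occurs⇒∈ 0-occurs
  letter∈𝓛 (suc zero) = occurs⇒∈ 1-occurs

  -- The membership proof is an irrelevant argument, so that the value
  -- depends only on the word and not on a chosen occurrence of it in c.
  record Homomorphism : Set where
    field
      value    : (w : Word) → .(w ∈ 𝓛) → ℕ
      positive : ∀ w (w∈𝓛 : w ∈ 𝓛) → 1 ℕ.≤ value w w∈𝓛

    onLetter : Letter → ℕ
    onLetter a = value List⁺.[ a ] (letter∈𝓛 a)

    field
      homo : ∀ w (w∈𝓛 : w ∈ 𝓛) → value w w∈𝓛 ≡ sum (List.map onLetter (toList w))

    Image : Pred ℤ 0ℓ
    Image v = ∃[ w ] ∃[ w∈𝓛 ] + value w w∈𝓛 ≡ v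

{-# OPTIONS --safe #-}

-- A factor of length n + 1 starting at position i contains q (i + n + 1) - q i
-- ones, which is q n or q n + 1, and these two counts give the two sets of values.
-- Both counts occur: cut a prefix of c into m consecutive blocks of length n + 1.
-- If all blocks had q n ones, then α ≤ q n / (n + 1) up to an error of order 1 / m;
-- if all had q n + 1 ones, then α ≥ (q n + 1) / (n + 1) up to such an error.
-- Openness of the cut at these two rationals provides an m that refutes each case.
module Submission where

open import Defs
open import Data.Empty using (⊥-elim)
open import Data.Fin.Base using (zero; suc; toℕ)
open import Data.Integer.Base as ℤ using (ℤ; +_; -[1+_]; +[1+_]; _+_; _-_; _*_)
import Data.Integer.Properties as ℤ
open import Data.Integer.Tactic.RingSolver using (solve-∀)
open import Data.List.Base as List using (applyUpTo)
open import Data.List.NonEmpty.Base using (_∷_; length)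
open import Data.List.Properties using (length-applyUpTo)
open import Data.Nat.Base as ℕ using (ℕ; zero; suc; s≤s)
open import Data.Nat.ListAction using (sum)
import Data.Nat.Properties as ℕ
import Data.Nat.Tactic.RingSolver as ℕ-Solver
open import Data.Product.Base using (∃-syntax; _×_; _,_)
open import Data.Rational.Base as ℚ using (mkℚ; 0ℚ; 1ℚ; _/_)
import Data.Rational.Properties as ℚ
open import Data.Sum.Base as Sum using (_⊎_; inj₁; inj₂)
open import Relation.Binary.PropositionalEquality
  using (_≡_; refl; sym; trans; cong; cong₂; subst; subst₂; module ≡-Reasoning)
open import Relation.Nullary.Decidable using (yes; no)
open import Relation.Unary using (_≐_; _∪_; _∈_)

-- Steps above or below a given average.

-- If the last step adds at most `b`, deleting it preserves the strict excess, so a larger step lies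
-- earlier.
∃-large-step : ∀ (f : ℕ → ℕ) b m → f 0 ℕ.+ m ℕ.* b ℕ.< f m →
               ∃[ t ] f t ℕ.+ b ℕ.< f (suc t)
∃-large-step f b zero f0<f0 =
  ⊥-elim (ℕ.<-irrefl refl (subst (ℕ._< f 0) (ℕ.+-identityʳ (f 0)) f0<f0))
∃-large-step f b (suc m) lt with f m ℕ.+ b ℕ.<? f (suc m)
... | yes large = m , large
... | no ¬large = ∃-large-step f b m (ℕ.+-cancelʳ-< b _ _ (begin-strict
  f 0 ℕ.+ m ℕ.* b ℕ.+ b     ≡⟨ regroup (f 0) (m ℕ.* b) b ⟩
  f 0 ℕ.+ suc m ℕ.* b       <⟨ lt ⟩
  f (suc m)                 ≤⟨ ℕ.≮⇒≥ ¬large ⟩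
  f m ℕ.+ b                 ∎))
  where
  open ℕ.≤-Reasoning
  regroup : ∀ x y z → x ℕ.+ y ℕ.+ z ≡ x ℕ.+ (z ℕ.+ y)
  regroup = ℕ-Solver.solve-∀

∃-small-step : ∀ (f : ℕ → ℕ) b m → f m ℕ.< f 0 ℕ.+ m ℕ.* b →
               ∃[ t ] f (suc t) ℕ.< f t ℕ.+ b
∃-small-step f b zero f0<f0 =
  ⊥-elim (ℕ.<-irrefl refl (subst (f 0 ℕ.<_) (ℕ.+-identityʳ (f 0)) f0<f0))
∃-small-step f b (suc m) lt with f (suc m) ℕ.<? f m ℕ.+ b
... | yes small = m , small
... | no ¬small = ∃-small-step f b m (ℕ.+-cancelʳ-< b _ _ (begin-strict
  f m ℕ.+ b                 ≤⟨ ℕ.≮⇒≥ ¬small ⟩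
  f (suc m)                 <⟨ lt ⟩
  f 0 ℕ.+ suc m ℕ.* b       ≡⟨ regroup (f 0) (m ℕ.* b) b ⟨
  f 0 ℕ.+ m ℕ.* b ℕ.+ b     ∎))
  where
  open ℕ.≤-Reasoning
  regroup : ∀ x y z → x ℕ.+ y ℕ.+ z ≡ x ℕ.+ (z ℕ.+ y)
  regroup = ℕ-Solver.solve-∀

-- A natural numerator lets later comparisons be cross-multiplied in `ℕ`.
positive-fraction : ∀ r → 0ℚ ℚ.< r → ∃[ p ] ∃[ d ] r ≡ + p / suc d
positive-fraction (mkℚ (+ zero) d _) (ℚ.*<* 0<0) = ⊥-elim (ℤ.<-irrefl refl 0<0)
positive-fraction (mkℚ -[1+ n ] d _) (ℚ.*<* ())
positive-fraction r@(mkℚ +[1+ n ] d _) _ = suc n , d , sym (ℚ.fromℚᵘ-toℚᵘ r)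

/-cancel-<-ℕ : ∀ m k n l → + m / suc k ℚ.< + n / suc l → m ℕ.* suc l ℕ.< n ℕ.* suc k
/-cancel-<-ℕ m k n l lt = ℤ.drop‿+<+
  (subst₂ ℤ._<_ (sym (ℤ.pos-* m (suc l))) (sym (ℤ.pos-* n (suc k)))
    (/-cancel-< (+ m) k (+ n) l lt))

-- Values of factors through their number of ones.

-- Interpolation between the letters 0 and 1: once summed, only the length and the number of ones
-- remain.
onLetter-affine : ∀ (s : Letter → ℕ) a →
                  + s a ≡ (+ s (suc zero) - + s zero) * + toℕ a + + s zero
onLetter-affine s zero       = at-0 (+ s zero) (+ s (suc zero))
  where
  at-0 : ∀ s₀ s₁ → s₀ ≡ (s₁ - s₀) * + 0 + s₀
  at-0 = solve-∀
onLetter-affine s (suc zero) = at-1 (+ s zero) (+ s (suc zero))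
  where
  at-1 : ∀ s₀ s₁ → s₁ ≡ (s₁ - s₀) * + 1 + s₀
  at-1 = solve-∀

-- By the affine formula the sum telescopes along `Q`. Keeping `Q` arbitrary lets the induction
-- shift `f` and `Q` together.
sum-prefix : ∀ (s : Letter → ℕ) (f : ℕ → Letter) (Q : ℕ → ℤ) →
             (∀ k → Q (suc k) ≡ + toℕ (f k) + Q k) →
             ∀ l → + sum (List.map s (applyUpTo f l)) ≡
                   (+ s (suc zero) - + s zero) * (Q l - Q 0) + + l * + s zero
sum-prefix s f Q Q-suc zero = empty (+ s zero) (+ s (suc zero)) (Q 0)
  where
  empty : ∀ s₀ s₁ x → + 0 ≡ (s₁ - s₀) * (x - x) + + 0 * s₀
  empty = solve-∀
sum-prefix s f Q Q-suc (suc l) = begin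
  + s (f 0) + + sum (List.map s (applyUpTo (λ k → f (suc k)) l))
    ≡⟨ cong₂ _+_ (onLetter-affine s (f 0))
         (sum-prefix s (λ k → f (suc k)) (λ k → Q (suc k)) (λ k → Q-suc (suc k)) l) ⟩
  (D * + toℕ (f 0) + + s zero) + (D * (Q (suc l) - Q 1) + + l * + s zero)
    ≡⟨ cong (λ x → (D * + toℕ (f 0) + + s zero) + (D * (Q (suc l) - x) + + l * + s zero))
         (Q-suc 0) ⟩
  (D * + toℕ (f 0) + + s zero) + (D * (Q (suc l) - (+ toℕ (f 0) + Q 0)) + + l * + s zero)
    ≡⟨ regroup (+ s zero) D (+ toℕ (f 0)) (Q 0) (Q (suc l)) (+ l) ⟩
  D * (Q (suc l) - Q 0) + + suc l * + s zero ∎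
  where
  open ≡-Reasoning
  D = + s (suc zero) - + s zero
  regroup : ∀ s₀ D a x y l → (D * a + s₀) + (D * (y - (a + x)) + l * s₀) ≡
            D * (y - x) + (+ 1 + l) * s₀
  regroup = solve-∀

-- To be read with `x = q i`, `y = q n`, `z = q (suc n + i)`: a light factor of length `suc n` has
-- `q n` ones.
light-value : ∀ s₀ s₁ {x y z} n → z ≡ x + y →
              (s₁ - s₀) * (z - x) + + suc n * s₀ ≡ (s₁ - s₀) * y + + n * s₀ + s₀
light-value s₀ s₁ {x} {y} n refl = regroup s₀ s₁ x y (+ n)
  where
  regroup : ∀ s₀ s₁ x y n → (s₁ - s₀) * ((x + y) - x) + (+ 1 + n) * s₀ ≡
            (s₁ - s₀) * y + n * s₀ + s₀
  regroup = solve-∀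

-- A heavy factor has one more 1, which trades a single `s₀` for `s₁`.
heavy-value : ∀ s₀ s₁ {x y z} n → z ≡ + 1 + (x + y) →
              (s₁ - s₀) * (z - x) + + suc n * s₀ ≡ (s₁ - s₀) * y + + n * s₀ + s₁
heavy-value s₀ s₁ {x} {y} n refl = regroup s₀ s₁ x y (+ n)
  where
  regroup : ∀ s₀ s₁ x y n → (s₁ - s₀) * ((+ 1 + (x + y)) - x) + (+ 1 + n) * s₀ ≡
            (s₁ - s₀) * y + n * s₀ + s₁
  regroup = solve-∀

module _ (α : ℝ) (α-irrational : Irrational α) (0<α : 0ℚ <ʳ α) (α<1 : α ʳ< 1ℚ) where
  open Sturmian α α-irrational 0<α α<1

  -- Additivity of the floors up to one.

  qℕ0≡0 : qℕ 0 ≡ 0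
  qℕ0≡0 = ℕ.n≤0⇒n≡0 (qℕ≤ 0)

  -- `α` lies strictly between `qℕ k / suc k` and `suc (qℕ l) / suc l`.
  qℕ-cross : ∀ k l → qℕ k ℕ.* suc l ℕ.< suc (qℕ l) ℕ.* suc k
  qℕ-cross k l = compareℕ k l (qℕ k) (suc (qℕ l)) (qℕ-lower k) (qℕ-upper l)

  -- The multiples of `α` add up as `suc i + suc n = suc N`. Comparing both `i` and `n` with `N`
  -- leaves a common factor `suc N` to cancel.
  qℕ-superadditive : ∀ n i → qℕ i ℕ.+ qℕ n ℕ.≤ qℕ (suc n ℕ.+ i)
  qℕ-superadditive n i = ℕ.≤-pred (ℕ.*-cancelʳ-< (suc N) _ _ (begin-strict
    (qℕ i ℕ.+ qℕ n) ℕ.* suc N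
      ≡⟨ ℕ.*-distribʳ-+ (suc N) (qℕ i) (qℕ n) ⟩
    qℕ i ℕ.* suc N ℕ.+ qℕ n ℕ.* suc N
      <⟨ ℕ.+-mono-< (qℕ-cross i N) (qℕ-cross n N) ⟩
    suc (qℕ N) ℕ.* suc i ℕ.+ suc (qℕ N) ℕ.* suc n
      ≡⟨ collect (suc (qℕ N)) n i ⟩
    suc (qℕ N) ℕ.* suc N ∎))
    where
    open ℕ.≤-Reasoning
    N = suc n ℕ.+ i
    collect : ∀ e n i → e ℕ.* suc i ℕ.+ e ℕ.* suc n ≡ e ℕ.* suc (suc n ℕ.+ i)
    collect = ℕ-Solver.solve-∀

  -- The reversed comparisons: two upper bounds lose 2 in total, and strictness recovers 1.
  qℕ-almost-subadditive : ∀ n i → qℕ (suc n ℕ.+ i) ℕ.≤ suc (qℕ i ℕ.+ qℕ n)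
  qℕ-almost-subadditive n i = ℕ.≤-pred (ℕ.*-cancelʳ-< (suc N) _ _ (begin-strict
    qℕ N ℕ.* suc N
      ≡⟨ expand (qℕ N) n i ⟩
    qℕ N ℕ.* suc i ℕ.+ qℕ N ℕ.* suc n
      <⟨ ℕ.+-mono-< (qℕ-cross N i) (qℕ-cross N n) ⟩
    suc (qℕ i) ℕ.* suc N ℕ.+ suc (qℕ n) ℕ.* suc N
      ≡⟨ collect (qℕ i) (qℕ n) (suc N) ⟩
    suc (suc (qℕ i ℕ.+ qℕ n)) ℕ.* suc N ∎))
    where
    open ℕ.≤-Reasoning
    N = suc n ℕ.+ i
    expand : ∀ e n i → e ℕ.* suc (suc n ℕ.+ i) ≡ e ℕ.* suc i ℕ.+ e ℕ.* suc n
    expand = ℕ-Solver.solve-∀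
    collect : ∀ a b k → suc a ℕ.* k ℕ.+ suc b ℕ.* k ≡ suc (suc (a ℕ.+ b)) ℕ.* k
    collect = ℕ-Solver.solve-∀

  qℕ-balanced : ∀ n i → qℕ (suc n ℕ.+ i) ≡ qℕ i ℕ.+ qℕ n ⊎
                        qℕ (suc n ℕ.+ i) ≡ suc (qℕ i ℕ.+ qℕ n)
  qℕ-balanced n i = Sum.map
    (λ { (s≤s ≤) → ℕ.≤-antisym ≤ (qℕ-superadditive n i) })
    (λ eq → eq)
    (ℕ.m≤n⇒m<n∨m≡n (qℕ-almost-subadditive n i))

  -- Rational approximations of `α` and extreme blocks.

  -- Opaque, as otherwise Agda compares the floors by unfolding the cuts behind them.
  opaque
    -- Openness of the cut yields a fraction strictly between `qℕ n / suc n` and `α`; its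
    -- denominator will be the number of blocks.
    approximation-below : ∀ n → ∃[ p ] ∃[ d ]
      (+ p / 1) <ʳ suc d · α × qℕ n ℕ.* suc d ℕ.< p ℕ.* suc n
    approximation-below n =
      let (r , q/n<r , r<α) =
            lower-open α (subst (Lower α) (/1*1/ (+ qℕ n) (suc n)) (qℕ-lower n))
          -- This makes `r` positive, hence a fraction with natural numerator.
          0≤q/n = ℚ.nonNegative⁻¹ (+ qℕ n / suc n) {{ℚ.normalize-nonNeg (qℕ n) (suc n)}}
          (p , d , r≡p/d) = positive-fraction r (ℚ.≤-<-trans 0≤q/n q/n<r)
      in p , d
        , subst (Lower α) (trans r≡p/d (sym (/1*1/ (+ p) (suc d)))) r<α
        , /-cancel-<-ℕ (qℕ n) n p d (subst (+ qℕ n / suc n ℚ.<_) r≡p/d q/n<r)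

    approximation-above : ∀ n → ∃[ p ] ∃[ d ]
      suc d · α ʳ< (+ p / 1) × p ℕ.* suc n ℕ.< suc (qℕ n) ℕ.* suc d
    approximation-above n =
      let (r , r<q/n , α<r) =
            upper-open α (subst (Upper α) (/1*1/ (+ suc (qℕ n)) (suc n)) (qℕ-upper n))
          (p , d , r≡p/d) = positive-fraction r (lower<upper α 0<α α<r)
      in p , d
        , subst (Upper α) (trans r≡p/d (sym (/1*1/ (+ p) (suc d)))) α<r
        , /-cancel-<-ℕ p d (suc (qℕ n)) n (subst (ℚ._< + suc (qℕ n) / suc n) r≡p/d r<q/n)

  -- The t-th block of length suc n has blockEnd n (suc t) ∸ blockEnd n t ones.
  blockEnd : ℕ → ℕ → ℕ
  blockEnd n t = qℕ (t ℕ.* suc n)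

  opaque
    -- With `p / suc d` from the approximation, `suc d` blocks hold at least `p * suc n` ones, on
    -- average more than `qℕ n` per block.
    many-ones : ∀ n → ∃[ m ] blockEnd n 0 ℕ.+ m ℕ.* qℕ n ℕ.< blockEnd n m
    many-ones n = let (p , d , p<dα , qd<pn) = approximation-below n in
      suc d , bound p d p<dα qd<pn
      where
      open ℕ.≤-Reasoning
      expand : ∀ p d n → p ℕ.* suc n ℕ.* suc d ℕ.+ p ≡ p ℕ.* suc (suc d ℕ.* suc n)
      expand = ℕ-Solver.solve-∀
      bound : ∀ p d → (+ p / 1) <ʳ suc d · α → qℕ n ℕ.* suc d ℕ.< p ℕ.* suc n →
              blockEnd n 0 ℕ.+ suc d ℕ.* qℕ n ℕ.< blockEnd n (suc d)
      bound p d p<dα qd<pn = begin-strict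
        qℕ 0 ℕ.+ suc d ℕ.* qℕ n   ≡⟨ cong (ℕ._+ suc d ℕ.* qℕ n) qℕ0≡0 ⟩
        suc d ℕ.* qℕ n            ≡⟨ ℕ.*-comm (suc d) (qℕ n) ⟩
        qℕ n ℕ.* suc d            <⟨ qd<pn ⟩
        p ℕ.* suc n               ≤⟨ ℕ.≤-pred (ℕ.*-cancelʳ-< (suc d) _ _ scaled) ⟩
        qℕ N                      ∎
        where
        N : ℕ
        N = suc d ℕ.* suc n
        scaled : p ℕ.* suc n ℕ.* suc d ℕ.< suc (qℕ N) ℕ.* suc d
        scaled = begin-strict
          -- `qℕ N` belongs to the multiple `suc N`, one beyond the `N` letters; the surplus `p` is
          -- harmless here.
          p ℕ.* suc n ℕ.* suc d          ≤⟨ ℕ.m≤m+n _ p ⟩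
          p ℕ.* suc n ℕ.* suc d ℕ.+ p    ≡⟨ expand p d n ⟩
          p ℕ.* suc N                    <⟨ compareℕ d N p (suc (qℕ N)) p<dα (qℕ-upper N) ⟩
          suc (qℕ N) ℕ.* suc d           ∎

    few-ones : ∀ n → ∃[ m ] blockEnd n m ℕ.< blockEnd n 0 ℕ.+ m ℕ.* suc (qℕ n)
    few-ones n = let (p , d , dα<p , pn<qd) = approximation-above n in
      suc d , bound p d dα<p pn<qd
      where
      open ℕ.≤-Reasoning
      expand : ∀ p d n → p ℕ.* suc (suc d ℕ.* suc n) ≡ p ℕ.+ p ℕ.* suc n ℕ.* suc d
      expand = ℕ-Solver.solve-∀
      bound : ∀ p d → suc d · α ʳ< (+ p / 1) → p ℕ.* suc n ℕ.< suc (qℕ n) ℕ.* suc d →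
              blockEnd n (suc d) ℕ.< blockEnd n 0 ℕ.+ suc d ℕ.* suc (qℕ n)
      bound p d dα<p pn<qd = begin-strict
        qℕ N                              <⟨ ℕ.*-cancelʳ-< (suc d) _ _ scaled ⟩
        suc (qℕ n) ℕ.* suc d              ≡⟨ ℕ.*-comm (suc (qℕ n)) (suc d) ⟩
        suc d ℕ.* suc (qℕ n)              ≡⟨ cong (ℕ._+ suc d ℕ.* suc (qℕ n)) qℕ0≡0 ⟨
        qℕ 0 ℕ.+ suc d ℕ.* suc (qℕ n)     ∎
        where
        N : ℕ
        N = suc d ℕ.* suc n
        p≤d : p ℕ.≤ suc d
        p≤d = ℕ.<⇒≤ (ℕ.*-cancelʳ-< (suc n) _ _ (begin-strict
          p ℕ.* suc n              <⟨ pn<qd ⟩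
          suc (qℕ n) ℕ.* suc d     ≤⟨ ℕ.*-monoˡ-≤ (suc d) (s≤s (qℕ≤ n)) ⟩
          suc n ℕ.* suc d          ≡⟨ ℕ.*-comm (suc n) (suc d) ⟩
          suc d ℕ.* suc n          ∎))
        scaled : qℕ N ℕ.* suc d ℕ.< suc (qℕ n) ℕ.* suc d ℕ.* suc d
        scaled = begin-strict
          qℕ N ℕ.* suc d                    <⟨ compareℕ N d (qℕ N) p (qℕ-lower N) dα<p ⟩
          p ℕ.* suc N                       ≡⟨ expand p d n ⟩
          -- Here the surplus `p` must be absorbed: it is at most `suc d`, and the strictness of
          -- `pn<qd` leaves room for one `suc d`.
          p ℕ.+ p ℕ.* suc n ℕ.* suc d       ≤⟨ ℕ.+-monoˡ-≤ _ p≤d ⟩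
          suc (p ℕ.* suc n) ℕ.* suc d       ≤⟨ ℕ.*-monoˡ-≤ (suc d) pn<qd ⟩
          suc (qℕ n) ℕ.* suc d ℕ.* suc d    ∎

  opaque
    light-factor : ∀ n → ∃[ i ] qℕ (suc n ℕ.+ i) ≡ qℕ i ℕ.+ qℕ n
    light-factor n =
      let (m , few)   = few-ones n
          (t , small) = ∃-small-step (blockEnd n) (suc (qℕ n)) m few
          i           = t ℕ.* suc n
      in i , ℕ.≤-antisym
        (ℕ.≤-pred (subst (qℕ (suc n ℕ.+ i) ℕ.<_) (ℕ.+-suc (qℕ i) (qℕ n)) small))
        (qℕ-superadditive n i)

    heavy-factor : ∀ n → ∃[ i ] qℕ (suc n ℕ.+ i) ≡ suc (qℕ i ℕ.+ qℕ n)
    heavy-factor n =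
      let (m , many)  = many-ones n
          (t , large) = ∃-large-step (blockEnd n) (qℕ n) m many
      -- `large` is the remaining inequality by computation: `suc t * suc n` unfolds to
      -- `suc n + t * suc n`, and `<` to `suc _ ≤ _`.
      in t ℕ.* suc n , ℕ.≤-antisym (qℕ-almost-subadditive n (t ℕ.* suc n)) large

  -- The unsimplified `i + 0` makes the underlying list equal to
  -- `applyUpTo (λ k → c (i + k)) (suc n)` by computation.
  factor : ℕ → ℕ → Word
  factor i n = c (i ℕ.+ 0) ∷ applyUpTo (λ k → c (i ℕ.+ suc k)) n

  length-factor : ∀ i n → length (factor i n) ≡ suc n
  length-factor i n = cong suc (length-applyUpTo (λ k → c (i ℕ.+ suc k)) n)

  factor∈𝓛 : ∀ i n → factor i n ∈ 𝓛
  factor∈𝓛 i n = i ,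
    cong (applyUpTo (λ k → c (i ℕ.+ k))) (sym (length-factor i n))

  q-light : ∀ n i → qℕ (suc n ℕ.+ i) ≡ qℕ i ℕ.+ qℕ n → q (suc n ℕ.+ i) ≡ q i + q n
  q-light n i eq = trans (sym (+qℕ (suc n ℕ.+ i)))
    (trans (cong +_ eq) (cong₂ _+_ (+qℕ i) (+qℕ n)))

  q-heavy : ∀ n i → qℕ (suc n ℕ.+ i) ≡ suc (qℕ i ℕ.+ qℕ n) →
            q (suc n ℕ.+ i) ≡ + 1 + (q i + q n)
  q-heavy n i eq = trans (sym (+qℕ (suc n ℕ.+ i)))
    (trans (cong +_ eq) (cong (λ x → + 1 + x) (cong₂ _+_ (+qℕ i) (+qℕ n))))

  module _ (S : Homomorphism) where
    open Homomorphism S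

    S₀ S₁ : ℤ
    S₀ = + onLetter zero
    S₁ = + onLetter (suc zero)

    sum-factor : ∀ i l → + sum (List.map onLetter (applyUpTo (λ k → c (i ℕ.+ k)) l)) ≡
                 (S₁ - S₀) * (q (l ℕ.+ i) - q i) + + l * S₀
    -- Writing `k + i` makes the initial value of the sequence compute to `q i`; commutativity is
    -- then needed only to match the letters.
    sum-factor i = sum-prefix onLetter (λ k → c (i ℕ.+ k)) (λ k → q (k ℕ.+ i))
      (λ k → trans (q-suc (k ℕ.+ i)) (cong (λ j → + toℕ (c j) + q (k ℕ.+ i)) (ℕ.+-comm k i)))

    factor-value : ∀ i n → + value (factor i n) (factor∈𝓛 i n) ≡
                   (S₁ - S₀) * (q (suc n ℕ.+ i) - q i) + + suc n * S₀
    factor-value i n = trans (cong +_ (homo (factor i n) (factor∈𝓛 i n))) (sum-factor i (suc n))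

    image : Image ≐ ((λ v → ∃[ n ] v ≡ (S₁ - S₀) * q n + + n * S₀ + S₀) ∪
                     (λ v → ∃[ n ] v ≡ (S₁ - S₀) * q n + + n * S₀ + S₁))
    image = to , from
      where
      to : ∀ {v} → v ∈ Image → _
      -- Exposing the head of the nonempty word makes its length compute to `suc n`, with `n` the
      -- index in the formulas.
      to (w@(_ ∷ as) , w∈𝓛@(i , w≡) , refl) = Sum.map
        (λ eq → n , trans w-value (light-value S₀ S₁ n (q-light n i eq)))
        (λ eq → n , trans w-value (heavy-value S₀ S₁ n (q-heavy n i eq)))
        (qℕ-balanced n i)
        where
        n = List.length as
        w-value : + value w w∈𝓛 ≡ (S₁ - S₀) * (q (suc n ℕ.+ i) - q i) + + suc n * S₀
        w-value = trans
          (cong +_ (trans (homo w w∈𝓛) (cong (λ u → sum (List.map onLetter u)) w≡)))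
          (sum-factor i (suc n))

      from : ∀ {v} → _ → v ∈ Image
      from (inj₁ (n , refl)) = let (i , eq) = light-factor n in
        factor i n , factor∈𝓛 i n , trans (factor-value i n) (light-value S₀ S₁ n (q-light n i eq))
      from (inj₂ (n , refl)) = let (i , eq) = heavy-factor n in
        factor i n , factor∈𝓛 i n , trans (factor-value i n) (heavy-value S₀ S₁ n (q-heavy n i eq))

theorem3 : (α : ℝ) (α-irrational : Irrational α) (0<α : 0ℚ <ʳ α) (α<1 : α ʳ< 1ℚ) →
    let open Sturmian α α-irrational 0<α α<1 in
    (S : Homomorphism) →
    let S₀ = + Homomorphism.onLetter S zero
        S₁ = + Homomorphism.onLetter S (suc zero)
    in Homomorphism.Image S ≐
         ((λ v → ∃[ n ] v ≡ (S₁ - S₀) * q n + + n * S₀ + S₀) ∪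
          (λ v → ∃[ n ] v ≡ (S₁ - S₀) * q n + + n * S₀ + S₁))
theorem3 = image
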